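{- Let $C$ be a binary singly even self-dual $[82,41,14]$ code with shadow $S$. Suppose that, for some integers $\alpha,\beta$, one of the following holds (the dots denote terms of higher degree): (i) $S$ has minimum weight $5$, and $$W_C=1+( 3280 + 2 \beta )y^{14}+( 36244 + 128 \alpha - 2 \beta )y^{16}+( 506153 - 896 \alpha - 26 \beta )y^{18}+ \cdots,$$ $$W_S=y^5+(- 18 + \alpha) y^9+( 153 - 16 \alpha - \beta) y^{13}+( 303568 + 120 \alpha + 14 \beta) y^{17}+ \cdots;$$ (ii) $S$ has minimum weight at least $9$, and $$W_C=1+( 3280 + 2 \beta )y^{14}+( 36244 + 128 \alpha - 2 \beta )y^{16}+( 514345 - 896 \alpha - 26 \beta )y^{18}+ \cdots,$$ $$W_S=\alpha y^9+( - 16 \alpha - \beta )y^{13}+( 304384 + 120 \alpha + 14 \beta )y^{17}+( 33293312 - 560 \alpha - 91 \beta )y^{21}+ \cdots.$$ Then $\beta$ is an even integer.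
   Context: All codes are binary: a code of length $n$ is a subspace of $\mathbb{F}_2^n$, and $[n,k,d]$ denotes length $n$, dimension $k$, minimum weight $d$. A code $C$ is self-dual if $C=C^\perp$ with respect to the standard inner product. A self-dual code is singly even if it contains a codeword of weight $\equiv 2 \pmod 4$. For a singly even self-dual code $C$, let $C_0$ be the subcode of codewords of weight $\equiv 0 \pmod 4$; the shadow of $C$ is $S=C_0^\perp\setminus C$. The weight enumerators are $W_C=\sum_i A_i y^i$ and $W_S=\sum_i B_i y^i$, where $A_i$ and $B_i$ are the numbers of vectors of weight $i$ in $C$ and $S$, respectively. Every singly even self-dual $[82,41,14]$ code with shadow of minimum weight $5$ (resp. at least $9$) has weight enumerators of the form in (i) (resp. (ii)) for some integers $\alpha,\beta$. -}

module Defs where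

open import Data.Bool.Base using (Bool; true; false; if_then_else_; _∧_; _xor_)
open import Data.Bool.Properties using (¬-not) renaming (_≟_ to _≟ᵇ_)
open import Data.Fin.Subset using (∣_∣)
open import Data.Fin.Subset.Properties using (anySubset?)
open import Data.Integer.Base using (ℤ; +_; 0ℤ) renaming (_+_ to _+ℤ_)
open import Data.List.Base as List using (List; []; _∷_; cartesianProductWith; filter; length)
open import Data.Nat.Base using (ℕ; zero; suc; _≤_; _%_; _≡ᵇ_; _⊔_)
open import Data.Nat.Properties using (_≟_)
open import Data.Product.Base using (∃; _×_; _,_; proj₂)
open import Data.Vec.Base as Vec using (Vec; []; _∷_; zipWith; replicate)
open import Data.Vec.Relation.Unary.All using (All)
open import Function.Base using (_∘_)
open import Level using (0ℓ)
open import Relation.Binary.PropositionalEquality using (_≡_; _≢_; sym; trans)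
open import Relation.Nullary.Negation using (contradiction)
open import Relation.Nullary.Decidable using (Dec; yes; no; _×-dec_)
open import Relation.Unary using (Pred; Decidable; _∈_; _∩_; ∁; _≐_)
open import Relation.Unary.Properties using (∁?; _∩?_)

-- Bool is the field F₂ (see xor-∧-commutativeRing), so Word n is F₂ⁿ.
-- It is definitionally Data.Fin.Subset.Subset n, a word being its support.

Word : ℕ → Set
Word n = Vec Bool n

module _ {n : ℕ} where

  infixl 6 _⊕_
  infixr 7 _•_
  infix 7 _·_

  0ʷ : Word n
  0ʷ = replicate n false

  _⊕_ : Word n → Word n → Word n
  _⊕_ = zipWith _xor_

  _•_ : Bool → Word n → Word n
  a • x = Vec.map (a ∧_) x

  _·_ : Word n → Word n → Bool
  x · y = Vec.foldr′ _xor_ false (zipWith _∧_ x y)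

  wt : Word n → ℕ
  wt x = ∣ x ∣

  linearCombination : ∀ {k} → Vec Bool k → Vec (Word n) k → Word n
  linearCombination a b = Vec.foldr′ _⊕_ 0ʷ (zipWith _•_ a b)

-- Classically every subset of the finite set F₂ⁿ is decidable; constructively
-- decidability is needed for the number of words of each weight to be defined.

record Code (n : ℕ) : Set₁ where
  field
    words     : Pred (Word n) 0ℓ
    words?    : Decidable words
    0-closed  : 0ʷ ∈ words
    ⊕-closed  : ∀ {x y} → x ∈ words → y ∈ words → x ⊕ y ∈ words
    •-closed  : ∀ a {x} → x ∈ words → a • x ∈ words

open Code public

record IsBasis {n k : ℕ} (C : Code n) (b : Vec (Word n) k) : Set where
  field
    members     : All (_∈ words C) b
    independent : ∀ a → linearCombination a b ≡ 0ʷ → a ≡ replicate k false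
    spanning    : ∀ {x} → x ∈ words C → ∃ λ a → linearCombination a b ≡ x

HasDimension : ∀ {n} → Code n → ℕ → Set
HasDimension {n} C k = ∃ λ (b : Vec (Word n) k) → IsBasis C b

record LeastWeight {n : ℕ} (P : Pred (Word n) 0ℓ) (d : ℕ) : Set where
  field
    attained : ∃ λ x → x ∈ P × wt x ≡ d
    least    : ∀ {x} → x ∈ P → d ≤ wt x

record Is[_,_,_] (n k d : ℕ) (C : Code n) : Set where
  field
    dimension     : HasDimension C k
    minimumWeight : LeastWeight (words C ∩ (_≢ 0ʷ)) d

module _ {n : ℕ} where

  dual : Pred (Word n) 0ℓ → Pred (Word n) 0ℓ
  dual P x = ∀ {y} → y ∈ P → x · y ≡ false

  dual? : {P : Pred (Word n) 0ℓ} → Decidable P → Decidable (dual P)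
  dual? P? x with anySubset? (λ y → P? y ×-dec (x · y ≟ᵇ true))
  ... | yes (y , y∈P , x·y≡1) = no λ x∈P⊥ →
    contradiction (trans (sym x·y≡1) (x∈P⊥ y∈P)) λ ()
  ... | no ∄y = yes λ {y} y∈P → ¬-not λ x·y≡1 → ∄y (y , y∈P , x·y≡1)

  SelfDual : Code n → Set
  SelfDual C = words C ≐ dual (words C)

  SinglyEven : Code n → Set
  SinglyEven C = ∃ λ x → x ∈ words C × wt x % 4 ≡ 2

  C₀ : Code n → Pred (Word n) 0ℓ
  C₀ C = words C ∩ (λ x → wt x % 4 ≡ 0)

  C₀? : (C : Code n) → Decidable (C₀ C)
  C₀? C = words? C ∩? (λ x → wt x % 4 ≟ 0)

  shadow : Code n → Pred (Word n) 0ℓ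
  shadow C = dual (C₀ C) ∩ ∁ (words C)

  shadow? : (C : Code n) → Decidable (shadow C)
  shadow? C = dual? (C₀? C) ∩? ∁? (words? C)

allWords : ∀ n → List (Word n)
allWords zero    = [] ∷ []
allWords (suc n) = cartesianProductWith _∷_ (false ∷ true ∷ []) (allWords n)

-- A weight enumerator is given by its coefficients: the value at i is the
-- coefficient of yⁱ.

weightEnumerator : ∀ {n} {P : Pred (Word n) 0ℓ} → Decidable P → ℕ → ℕ
weightEnumerator {n} P? i =
  length (filter (λ x → P? x ×-dec (wt x ≟ i)) (allWords n))

-- A polynomial written as a list of terms  c y^ e.

infix 6 _y^_

_y^_ : ℤ → ℕ → ℤ × ℕ
c y^ e = c , e

Polynomial : Set
Polynomial = List (ℤ × ℕ)

coefficient : Polynomial → ℕ → ℤ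
coefficient []            i = 0ℤ
coefficient ((c , e) ∷ p) i = (if e ≡ᵇ i then c else 0ℤ) +ℤ coefficient p i

-- The largest exponent written down, even if its coefficient happens to be 0.

formalDegree : Polynomial → ℕ
formalDegree = List.foldr (_⊔_ ∘ proj₂) 0

-- W ≈ p +⋯ : W is p plus terms of degree greater than those of p. In particular
-- the coefficients of W at the exponents skipped in p vanish.

infix 4 _≈_+⋯

_≈_+⋯ : (ℕ → ℕ) → Polynomial → Set
W ≈ p +⋯ = ∀ i → i ≤ formalDegree p → + W i ≡ coefficient p i

module Submission where

-- In both cases the claim is that B₅ + B₁₃ is even. Let S be the shadow and fix s ∈ S of
-- weight 1 mod 4 (without one, B₅ = B₁₃ = 0); then all of S has weight 1 mod 4, and S = s ⊕ C. Since C is self-dual,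
-- f(x) = (-1)^(s·x) on S, extended by 0, satisfies f̂ = -∣C∣ f = -2⁴¹ f. Its counts
-- Dₖ = Σ f(x) over the words x of weight k are congruent to Bₖ mod 2, and the binomial moments
-- of f and f̂ give
--   Σₖ Dₖ (2ⁱ (82-k choose i) + 2⁴¹ (82-k choose 82-i)) = 0   for 0 ≤ i ≤ 82.
-- As Dₖ = 0 unless k = 5, 9, …, 77, combining i = 0, …, 16 so that the first terms add up to
-- a polynomial vanishing at k = 17, 21, …, 77 leaves D₁₃ + 14 D₉ + 105 D₅ = 0, hence
-- B₁₃ + B₅ ≡ D₁₃ + D₅ ≡ 0 mod 2.

open import Defs
open import Algebra.Bundles using (CommutativeMonoid; CommutativeRing)
open import Data.Bool.Base using (Bool; true; false; if_then_else_; not; _∧_; _xor_)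
open import Data.Bool.Properties
  using (∧-comm; ∧-distribʳ-xor; xor-assoc; xor-comm; xor-identityʳ; xor-same; xor-∧-commutativeRing; ¬-not)
  renaming (_≟_ to _≟ᵇ_)
open import Data.Empty using (⊥-elim)
open import Data.Fin.Subset using (_∩_) renaming (∁ to complement)
open import Data.Fin.Subset.Properties using (anySubset?; ∩-idem; ∣p∣≤n; ∣∁p∣≡n∸∣p∣)
open import Data.Integer using (ℤ; +_; -_; _+_; _-_; _*_)
open import Data.Integer.Base using (NonZero)
open import Data.Integer.Divisibility using (_∣_)
open import Data.Integer.Divisibility.Signed using (∣⇒∣ᵤ; divides)
open import Data.Integer.Properties as ℤ
  using (+-comm; *-assoc; *-comm; *-distribˡ-+; *-zeroʳ; *-identityʳ; pos-+; pos-*)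
open import Data.Integer.Tactic.RingSolver using (solve-∀)
open import Data.List.Base using (List; []; _∷_; _++_; filter; length; map)
open import Data.List.Properties using (filter-++; length-++)
open import Data.Nat.Base as ℕ using (ℕ; zero; suc; _≤_; _<_; s≤s; _%_)
open import Data.Nat.Combinatorics using (nCk+nC[k+1]≡[n+1]C[k+1]; k>n⇒nCk≡0)
  renaming (_C_ to _choose_)
open import Data.Nat.DivMod using ([m+kn]%n≡m%n)
open import Data.Nat.Properties as ℕ using (_≟_)
import Data.Nat.Tactic.RingSolver as ℕRing
open import Data.Product.Base using (∃; ∃₂; _×_; _,_; proj₁; proj₂)
open import Data.Sum.Base using (_⊎_; inj₁; inj₂)
open import Data.Unit.Base using (tt)
open import Data.Vec.Base using ([]; _∷_; replicate)
open import Data.Vec.Properties using (zipWith-comm; zipWith-replicate₁)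
open import Function.Base using (_∘_; _$_)
open import Function.Bundles using (_⇔_; mk⇔)
open import Level using (0ℓ)
open import Relation.Binary.Definitions using (tri<; tri≈; tri>)
open import Relation.Binary.PropositionalEquality
open import Relation.Nullary.Decidable using (Dec; yes; no; does; does-⇔; toWitness; _×-dec_; _→-dec_)
open import Relation.Nullary.Negation using (contradiction)
open import Relation.Unary using (Pred; Decidable; _∈_; _∉_)

open import Algebra.Properties.CommutativeSemigroup ℤ.+-commutativeSemigroup
  using () renaming (interchange to +-interchange)
open import Algebra.Properties.CommutativeSemigroup
  (CommutativeMonoid.commutativeSemigroup (CommutativeRing.+-commutativeMonoid xor-∧-commutativeRing))
  using () renaming (interchange to xor-interchange)

open ≡-Reasoning

private
  variable
    n : ℕ

-- Sums over F₂ⁿ.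

∑ : (Word n → ℤ) → ℤ
∑ {zero}  φ = φ []
∑ {suc n} φ = ∑ (λ x → φ (false ∷ x)) + ∑ (λ x → φ (true ∷ x))

∑-cong : {φ ψ : Word n → ℤ} → (∀ x → φ x ≡ ψ x) → ∑ φ ≡ ∑ ψ
∑-cong {zero}  φ≗ψ = φ≗ψ []
∑-cong {suc n} φ≗ψ = cong₂ _+_ (∑-cong (φ≗ψ ∘ (false ∷_))) (∑-cong (φ≗ψ ∘ (true ∷_)))

∑-+ : (φ ψ : Word n → ℤ) → ∑ (λ x → φ x + ψ x) ≡ ∑ φ + ∑ ψ
∑-+ {zero}  φ ψ = refl
∑-+ {suc n} φ ψ = trans
  (cong₂ _+_ (∑-+ (φ ∘ (false ∷_)) (ψ ∘ (false ∷_))) (∑-+ (φ ∘ (true ∷_)) (ψ ∘ (true ∷_))))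
  (+-interchange (∑ (φ ∘ (false ∷_))) _ _ _)

∑-* : ∀ a (φ : Word n → ℤ) → ∑ (λ x → a * φ x) ≡ a * ∑ φ
∑-* {zero}  a φ = refl
∑-* {suc n} a φ = trans
  (cong₂ _+_ (∑-* a (φ ∘ (false ∷_))) (∑-* a (φ ∘ (true ∷_))))
  (sym (*-distribˡ-+ a (∑ (φ ∘ (false ∷_))) _))

∑-zero : {φ : Word n → ℤ} → (∀ x → φ x ≡ + 0) → ∑ φ ≡ + 0
∑-zero {zero}  φ≗0 = φ≗0 []
∑-zero {suc n} φ≗0 = cong₂ _+_ (∑-zero (φ≗0 ∘ (false ∷_))) (∑-zero (φ≗0 ∘ (true ∷_)))

∑-swap : ∀ {m} (φ : Word m → Word n → ℤ) → ∑ (λ x → ∑ (φ x)) ≡ ∑ (λ y → ∑ (λ x → φ x y))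
∑-swap {m = zero}  φ = refl
∑-swap {m = suc m} φ = trans
  (cong₂ _+_ (∑-swap (φ ∘ (false ∷_))) (∑-swap (φ ∘ (true ∷_))))
  (sym (∑-+ (λ y → ∑ (λ x → φ (false ∷ x) y)) (λ y → ∑ (λ x → φ (true ∷ x) y))))

∑-translate : ∀ t (φ : Word n → ℤ) → ∑ (λ x → φ (x ⊕ t)) ≡ ∑ φ
∑-translate []          φ = refl
∑-translate (false ∷ t) φ = cong₂ _+_ (∑-translate t (φ ∘ (false ∷_))) (∑-translate t (φ ∘ (true ∷_)))
∑-translate (true ∷ t)  φ = trans
  (cong₂ _+_ (∑-translate t (φ ∘ (true ∷_))) (∑-translate t (φ ∘ (false ∷_))))
  (+-comm (∑ (φ ∘ (true ∷_))) _)

-- Iverson brackets, and counts as sums.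

⟦_⟧ : {A : Set} → Dec A → ℤ
⟦ a? ⟧ = if does a? then + 1 else + 0

⟦⟧-cong : {A B : Set} (a? : Dec A) (b? : Dec B) → A ⇔ B → ⟦ a? ⟧ ≡ ⟦ b? ⟧
⟦⟧-cong a? b? A⇔B = cong (if_then + 1 else + 0) (does-⇔ A⇔B a? b?)

⟦×⟧ : {A B : Set} (a? : Dec A) (b? : Dec B) → ⟦ a? ×-dec b? ⟧ ≡ ⟦ a? ⟧ * ⟦ b? ⟧
⟦×⟧ a? b? with does a? | does b?
... | true  | true  = refl
... | true  | false = refl
... | false | _     = refl

⟦⟧-*-cong : {A : Set} (a? : Dec A) {i j : ℤ} → (A → i ≡ j) → ⟦ a? ⟧ * i ≡ ⟦ a? ⟧ * j
⟦⟧-*-cong (yes a) i≡j = cong (+ 1 *_) (i≡j a)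
⟦⟧-*-cong (no _)  _   = refl

length-filter-map : {A B : Set} {P : Pred B 0ℓ} (P? : Decidable P) (f : A → B) (xs : List A) →
                    length (filter P? (map f xs)) ≡ length (filter (P? ∘ f) xs)
length-filter-map P? f []       = refl
length-filter-map P? f (x ∷ xs) with does (P? (f x))
... | true  = cong suc (length-filter-map P? f xs)
... | false = length-filter-map P? f xs

count≡∑ : {P : Pred (Word n) 0ℓ} (P? : Decidable P) →
          + length (filter P? (allWords n)) ≡ ∑ (λ x → ⟦ P? x ⟧)
count≡∑ {zero} P? with does (P? [])
... | true  = refl
... | false = refl
count≡∑ {suc n} P? = begin
  -- `allWords (suc n)` unfolds to the words with first bit 0, those with first bit 1, and a
  -- trailing `[]`.
  + length (filter P? (map (false ∷_) ws ++ map (true ∷_) ws ++ []))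
    ≡⟨ cong (λ v → + length v) (trans (filter-++ P? (map (false ∷_) ws) _)
         (cong (filter P? (map (false ∷_) ws) ++_) (filter-++ P? (map (true ∷_) ws) []))) ⟩
  + length (filter P? (map (false ∷_) ws) ++ filter P? (map (true ∷_) ws) ++ [])
    ≡⟨ cong +_ (trans (length-++ (filter P? (map (false ∷_) ws)))
         (cong (length (filter P? (map (false ∷_) ws)) ℕ.+_)
           (trans (length-++ (filter P? (map (true ∷_) ws))) (ℕ.+-identityʳ _)))) ⟩
  + (length (filter P? (map (false ∷_) ws)) ℕ.+ length (filter P? (map (true ∷_) ws)))
    ≡⟨ cong₂ (λ a b → + (a ℕ.+ b)) (length-filter-map P? (false ∷_) ws) (length-filter-map P? (true ∷_) ws) ⟩
  + (length (filter (P? ∘ (false ∷_)) ws) ℕ.+ length (filter (P? ∘ (true ∷_)) ws))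
    ≡⟨ pos-+ (length (filter (P? ∘ (false ∷_)) ws)) _ ⟩
  + length (filter (P? ∘ (false ∷_)) ws) + + length (filter (P? ∘ (true ∷_)) ws)
    ≡⟨ cong₂ _+_ (count≡∑ (P? ∘ (false ∷_))) (count≡∑ (P? ∘ (true ∷_))) ⟩
  ∑ (λ x → ⟦ P? x ⟧) ∎
  where ws = allWords n

-- Inner products and weights.

·-comm : (x y : Word n) → x · y ≡ y · x
·-comm []      []      = refl
·-comm (a ∷ x) (b ∷ y) = cong₂ _xor_ (∧-comm a b) (·-comm x y)

·-distribʳ-⊕ : (x y z : Word n) → (x ⊕ y) · z ≡ (x · z) xor (y · z)
·-distribʳ-⊕ []      []      []      = refl
·-distribʳ-⊕ (a ∷ x) (b ∷ y) (c ∷ z) = trans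
  (cong₂ _xor_ (∧-distribʳ-xor c a b) (·-distribʳ-⊕ x y z))
  (xor-interchange (a ∧ c) (b ∧ c) (x · z) (y · z))

·-distribˡ-⊕ : (x y z : Word n) → x · (y ⊕ z) ≡ (x · y) xor (x · z)
·-distribˡ-⊕ x y z = trans (·-comm x (y ⊕ z))
  (trans (·-distribʳ-⊕ y z x) (cong₂ _xor_ (·-comm y x) (·-comm z x)))

·-zeroʳ : (x : Word n) → x · 0ʷ ≡ false
·-zeroʳ []          = refl
·-zeroʳ (false ∷ x) = ·-zeroʳ x
·-zeroʳ (true ∷ x)  = ·-zeroʳ x

⊕-cancelʳ : (x y : Word n) → (x ⊕ y) ⊕ y ≡ x
⊕-cancelʳ []      []      = refl
⊕-cancelʳ (a ∷ x) (b ∷ y) = cong₂ _∷_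
  (trans (xor-assoc a b b) (trans (cong (a xor_) (xor-same b)) (xor-identityʳ a)))
  (⊕-cancelʳ x y)

⊕-comm : (x y : Word n) → x ⊕ y ≡ y ⊕ x
⊕-comm = zipWith-comm xor-comm

bit : Bool → ℕ
bit b = if b then 1 else 0

wt-∩ : (x y : Word n) → ∃ λ k → wt (x ∩ y) ≡ bit (x · y) ℕ.+ k ℕ.* 2
wt-∩ []          []          = 0 , refl
wt-∩ (false ∷ x) (b ∷ y)     = wt-∩ x y
wt-∩ (true ∷ x)  (false ∷ y) = wt-∩ x y
wt-∩ (true ∷ x)  (true ∷ y)  with x · y | wt-∩ x y
... | false | k , eq = k , cong suc eq
... | true  | k , eq = suc k , cong suc eq

wt-⊕-∩ : (x y : Word n) → wt (x ⊕ y) ℕ.+ wt (x ∩ y) ℕ.* 2 ≡ wt x ℕ.+ wt y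
wt-⊕-∩ []          []          = refl
wt-⊕-∩ (false ∷ x) (false ∷ y) = wt-⊕-∩ x y
wt-⊕-∩ (false ∷ x) (true ∷ y)  = trans (cong suc (wt-⊕-∩ x y)) (sym (ℕ.+-suc (wt x) (wt y)))
wt-⊕-∩ (true ∷ x)  (false ∷ y) = cong suc (wt-⊕-∩ x y)
wt-⊕-∩ (true ∷ x)  (true ∷ y)  = begin
  wt (x ⊕ y) ℕ.+ suc (suc (wt (x ∩ y) ℕ.* 2)) ≡⟨ ℕ.+-suc (wt (x ⊕ y)) _ ⟩
  suc (wt (x ⊕ y) ℕ.+ suc (wt (x ∩ y) ℕ.* 2)) ≡⟨ cong suc (ℕ.+-suc (wt (x ⊕ y)) _) ⟩
  suc (suc (wt (x ⊕ y) ℕ.+ wt (x ∩ y) ℕ.* 2)) ≡⟨ cong (suc ∘ suc) (wt-⊕-∩ x y) ⟩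
  suc (suc (wt x ℕ.+ wt y))                   ≡⟨ cong suc (ℕ.+-suc (wt x) (wt y)) ⟨
  suc (wt x ℕ.+ suc (wt y))                   ∎

-- Twice `wt (x ∩ y)` is lost in the sum, and `wt-∩` gives `wt (x ∩ y)` mod 2, so `wt (x ⊕ y)` is
-- fixed mod 4. The form is additive because subtraction in ℕ truncates.
wt-⊕ : (x y : Word n) → ∃ λ k → wt (x ⊕ y) ℕ.+ (bit (x · y) ℕ.+ k ℕ.* 2) ℕ.* 2 ≡ wt x ℕ.+ wt y
wt-⊕ x y with k , eq ← wt-∩ x y = k , trans
  (cong (λ v → wt (x ⊕ y) ℕ.+ v ℕ.* 2) (sym eq)) (wt-⊕-∩ x y)

wt-self : (x : Word n) → ∃ λ k → wt x ≡ bit (x · x) ℕ.+ k ℕ.* 2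
wt-self x with k , eq ← wt-∩ x x = k , trans (cong wt (sym (∩-idem x))) eq

1ʷ : Word n
1ʷ = replicate _ true

·-1ʷ : (x : Word n) → 1ʷ · x ≡ x · x
·-1ʷ []          = refl
·-1ʷ (false ∷ x) = ·-1ʷ x
·-1ʷ (true ∷ x)  = cong not (·-1ʷ x)

-- `zeros x choose i` is the number of i-sets of coordinates on which `x` vanishes; weights enter
-- the moments in this form.
zeros : Word n → ℕ
zeros x = wt (complement x)

zeros≤n : (x : Word n) → zeros x ≤ n
zeros≤n x = ∣p∣≤n (complement x)

wt-1ʷ⊕ : (x : Word n) → wt (1ʷ ⊕ x) ≡ n ℕ.∸ wt x
wt-1ʷ⊕ x = trans (cong wt (zipWith-replicate₁ _xor_ true x)) (∣∁p∣≡n∸∣p∣ x)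

-- Characters of F₂ⁿ and binomial moments.

sign : Bool → ℤ
sign false = + 1
sign true  = - + 1

sign-xor : ∀ a b → sign (a xor b) ≡ sign a * sign b
sign-xor false false = refl
sign-xor false true  = refl
sign-xor true  false = refl
sign-xor true  true  = refl

-- Only `0ʷ` has `n` zeros, so the binomial is 1 there and 0 elsewhere.
∑-select-0ʷ : (φ : Word n → ℤ) → ∑ (λ y → φ y * + (zeros y choose n)) ≡ φ 0ʷ
∑-select-0ʷ {zero}  φ = *-identityʳ (φ [])
∑-select-0ʷ {suc n} φ = begin
  ∑ (λ y → φ (false ∷ y) * + (suc (zeros y) choose suc n)) + ∑ (λ y → φ (true ∷ y) * + (zeros y choose suc n))
    ≡⟨ cong₂ _+_ (∑-cong λ y → cong (λ v → φ (false ∷ y) * + v) (pascal y))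
                 (∑-zero λ y → trans (cong (λ v → φ (true ∷ y) * + v) (vanishes y)) (*-zeroʳ (φ (true ∷ y)))) ⟩
  ∑ (λ y → φ (false ∷ y) * + (zeros y choose n)) + + 0
    ≡⟨ trans (ℤ.+-identityʳ _) (∑-select-0ʷ (φ ∘ (false ∷_))) ⟩
  φ 0ʷ ∎
  where
  vanishes : (y : Word n) → zeros y choose suc n ≡ 0
  vanishes y = k>n⇒nCk≡0 (s≤s (zeros≤n y))
  pascal : (y : Word n) → suc (zeros y) choose suc n ≡ zeros y choose n
  pascal y = trans (sym (nCk+nC[k+1]≡[n+1]C[k+1] (zeros y) n))
    (trans (cong (zeros y choose n ℕ.+_) (vanishes y)) (ℕ.+-identityʳ _))

pascal : ∀ m k → + (suc m choose suc k) ≡ + (m choose k) + + (m choose suc k)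
pascal m k = trans (cong +_ (sym (nCk+nC[k+1]≡[n+1]C[k+1] m k))) (pos-+ (m choose k) _)

-- The signs summed over the words y vanishing on a given r-set cancel unless x vanishes on
-- its complement, an i-set, in which case they add up to 2ⁱ.
∑-sign-binomial : (x : Word n) (i r : ℕ) → i ℕ.+ r ≡ n →
                  ∑ (λ y → sign (x · y) * + (zeros y choose r)) ≡ + (2 ℕ.^ i) * + (zeros x choose i)
∑-sign-binomial {n} x zero r refl = trans (∑-select-0ʷ (λ y → sign (x · y))) (cong sign (·-zeroʳ x))
∑-sign-binomial {suc n} (b ∷ x) (suc i) r eq = cases b r (ℕ.suc-injective eq)
  where
  m : ℕ → ℤ
  m r = ∑ (λ y → sign (x · y) * + (zeros y choose r))

  m-pascal : ∀ r → ∑ (λ y → sign (x · y) * + (suc (zeros y) choose suc r)) ≡ m r + m (suc r)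
  m-pascal r = trans
    (∑-cong λ y → trans (cong (sign (x · y) *_) (pascal (zeros y) r)) (*-distribˡ-+ (sign (x · y)) _ _))
    (∑-+ (λ y → sign (x · y) * + (zeros y choose r)) _)

  m-neg : ∀ r → ∑ (λ y → sign (not (x · y)) * + (zeros y choose r)) ≡ - + 1 * m r
  m-neg r = trans
    (∑-cong λ y → trans (cong (_* + (zeros y choose r)) (sign-xor true (x · y)))
                        (*-assoc (- + 1) (sign (x · y)) _))
    (∑-* (- + 1) (λ y → sign (x · y) * + (zeros y choose r)))

  -- For the case `r = 0`, where `x` has only `i` coordinates. That case is separate because
  -- Pascal's rule does not split `choose 0`.
  C-vanishes : i ≡ n → + (zeros x choose suc i) ≡ + 0
  C-vanishes refl = cong +_ (k>n⇒nCk≡0 (s≤s (zeros≤n x)))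

  cases : ∀ b r → i ℕ.+ r ≡ n →
          ∑ (λ y → sign ((b ∷ x) · y) * + (zeros y choose r)) ≡ + (2 ℕ.^ suc i) * + (zeros (b ∷ x) choose suc i)
  cases false zero i+0≡n = begin
    m 0 + m 0
      ≡⟨ cong₂ _+_ (∑-sign-binomial x i 0 i+0≡n) (∑-sign-binomial x i 0 i+0≡n) ⟩
    + (2 ℕ.^ i) * + (zeros x choose i) + + (2 ℕ.^ i) * + (zeros x choose i)
      ≡⟨ double (+ (2 ℕ.^ i)) (+ (zeros x choose i)) ⟩
    (+ 2 * + (2 ℕ.^ i)) * (+ (zeros x choose i) + + 0)
      ≡⟨ cong₂ (λ u v → u * (+ (zeros x choose i) + v)) (pos-* 2 (2 ℕ.^ i))
           (C-vanishes (trans (sym (ℕ.+-identityʳ i)) i+0≡n)) ⟨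
    + (2 ℕ.^ suc i) * (+ (zeros x choose i) + + (zeros x choose suc i))
      ≡⟨ cong (+ (2 ℕ.^ suc i) *_) (pascal (zeros x) i) ⟨
    + (2 ℕ.^ suc i) * + (suc (zeros x) choose suc i) ∎
    where
    double : ∀ p c → p * c + p * c ≡ (+ 2 * p) * (c + + 0)
    double = solve-∀
  cases true zero i+0≡n = begin
    m 0 + ∑ (λ y → sign (not (x · y)) * + (zeros y choose 0))
      ≡⟨ cong (_+_ (m 0)) (m-neg 0) ⟩
    m 0 + - + 1 * m 0
      ≡⟨ cancel (m 0) (+ (2 ℕ.^ suc i)) ⟩
    + (2 ℕ.^ suc i) * + 0
      ≡⟨ cong (+ (2 ℕ.^ suc i) *_) (C-vanishes (trans (sym (ℕ.+-identityʳ i)) i+0≡n)) ⟨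
    + (2 ℕ.^ suc i) * + (zeros x choose suc i) ∎
    where
    cancel : ∀ a p → a + - + 1 * a ≡ p * + 0
    cancel = solve-∀
  cases false (suc r) i+[1+r]≡n = begin
    ∑ (λ y → sign (x · y) * + (suc (zeros y) choose suc r)) + m (suc r)
      ≡⟨ cong (_+ m (suc r)) (m-pascal r) ⟩
    (m r + m (suc r)) + m (suc r)
      ≡⟨ cong₂ (λ u v → (u + v) + v) (∑-sign-binomial x (suc i) r (trans (sym (ℕ.+-suc i r)) i+[1+r]≡n))
           (∑-sign-binomial x i (suc r) i+[1+r]≡n) ⟩
    (+ (2 ℕ.^ suc i) * + (zeros x choose suc i) + + (2 ℕ.^ i) * + (zeros x choose i)) + + (2 ℕ.^ i) * + (zeros x choose i)
      ≡⟨ cong (λ u → (u * + (zeros x choose suc i) + + (2 ℕ.^ i) * + (zeros x choose i)) + + (2 ℕ.^ i) * + (zeros x choose i))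
           (pos-* 2 (2 ℕ.^ i)) ⟩
    ((+ 2 * + (2 ℕ.^ i)) * + (zeros x choose suc i) + + (2 ℕ.^ i) * + (zeros x choose i)) + + (2 ℕ.^ i) * + (zeros x choose i)
      ≡⟨ collect (+ (2 ℕ.^ i)) (+ (zeros x choose i)) (+ (zeros x choose suc i)) ⟩
    (+ 2 * + (2 ℕ.^ i)) * (+ (zeros x choose i) + + (zeros x choose suc i))
      ≡⟨ cong₂ _*_ (pos-* 2 (2 ℕ.^ i)) (pascal (zeros x) i) ⟨
    + (2 ℕ.^ suc i) * + (suc (zeros x) choose suc i) ∎
    where
    collect : ∀ p c d → ((+ 2 * p) * d + p * c) + p * c ≡ (+ 2 * p) * (c + d)
    collect = solve-∀
  cases true (suc r) i+[1+r]≡n = begin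
    ∑ (λ y → sign (x · y) * + (suc (zeros y) choose suc r)) + ∑ (λ y → sign (not (x · y)) * + (zeros y choose suc r))
      ≡⟨ cong₂ _+_ (m-pascal r) (m-neg (suc r)) ⟩
    (m r + m (suc r)) + - + 1 * m (suc r)
      ≡⟨ cancel (m r) (m (suc r)) ⟩
    m r
      ≡⟨ ∑-sign-binomial x (suc i) r (trans (sym (ℕ.+-suc i r)) i+[1+r]≡n) ⟩
    + (2 ℕ.^ suc i) * + (zeros x choose suc i) ∎
    where
    cancel : ∀ a b → (a + b) + - + 1 * b ≡ a
    cancel = solve-∀

-- Arithmetic of signs, squares and residues.

a≡-a⇒a≡0 : ∀ {a} → a ≡ - + 1 * a → a ≡ + 0
a≡-a⇒a≡0 {a} a≡-a with ℤ.i*j≡0⇒i≡0∨j≡0 (+ 2) {a} (trans (double a) (trans (cong (_+_ a) a≡-a) (cancel a)))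
  where
  double : ∀ a → + 2 * a ≡ a + a
  double = solve-∀
  cancel : ∀ a → a + - + 1 * a ≡ + 0
  cancel = solve-∀
... | inj₂ a≡0 = a≡0

square-injective : ∀ {a b} → a ℕ.* a ≡ b ℕ.* b → a ≡ b
square-injective {a} {b} a²≡b² with ℕ.<-cmp a b
... | tri< a<b _ _ = contradiction a²≡b² (ℕ.<⇒≢ (ℕ.*-mono-< a<b a<b))
... | tri≈ _ a≡b _ = a≡b
... | tri> _ _ b<a = contradiction (sym a²≡b²) (ℕ.<⇒≢ (ℕ.*-mono-< b<a b<a))

halve : ∀ k → ∃₂ λ b j → k ≡ bit b ℕ.+ j ℕ.* 2
halve zero = false , 0 , refl
halve (suc k) with halve k
... | false , j , eq = true , j , cong suc eq
... | true  , j , eq = false , suc j , cong suc eq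

wt%4≡1⇒odd : (x : Word n) → wt x % 4 ≡ 1 → x · x ≡ true
wt%4≡1⇒odd x wt-x%4 with x · x | wt-self x
... | true  | _ = refl
... | false | k , wt-x with halve k
... | b , j , refl = contradiction (begin
  (bit b ℕ.* 2) % 4                       ≡⟨ [m+kn]%n≡m%n (bit b ℕ.* 2) j 4 ⟨
  (bit b ℕ.* 2 ℕ.+ j ℕ.* 4) % 4           ≡⟨ cong (_% 4) (regroup (bit b) j) ⟨
  ((bit b ℕ.+ j ℕ.* 2) ℕ.* 2) % 4         ≡⟨ cong (_% 4) wt-x ⟨
  wt x % 4                                ≡⟨ wt-x%4 ⟩
  1                                       ∎) (≢1 b)
  where
  regroup : ∀ b j → (b ℕ.+ j ℕ.* 2) ℕ.* 2 ≡ b ℕ.* 2 ℕ.+ j ℕ.* 4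
  regroup = ℕRing.solve-∀

  ≢1 : ∀ b → (bit b ℕ.* 2) % 4 ≢ 1
  ≢1 false ()
  ≢1 true  ()

-- With N = ∣C∣, the weights of a signed sum that vanishes by ∑-signedShadow-binomial.
binomialCombination : ℕ → ℤ → List ℤ → ℕ → ℕ → ℤ
binomialCombination n N []       i z = + 0
binomialCombination n N (l ∷ ls) i z =
  l * (+ (2 ℕ.^ i) * + (z choose i) + N * + (z choose (n ℕ.∸ i))) + binomialCombination n N ls (suc i) z

-- The shadow of a self-dual code as a coset of the code.

module SelfDualCode {n : ℕ} (C : Code n) (C≐C⊥ : SelfDual C) where

  orthogonal : ∀ {x y} → x ∈ words C → y ∈ words C → x · y ≡ false
  orthogonal x∈C y∈C = proj₁ C≐C⊥ x∈C y∈C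

  -- A word orthogonal to all codewords lies in C⊥ = C; the finite search turns the failure of this
  -- into a witness.
  nonorthogonal-codeword : ∀ {x} → x ∉ words C → ∃ λ c → c ∈ words C × x · c ≡ true
  nonorthogonal-codeword {x} x∉C with anySubset? (λ c → words? C c ×-dec (x · c ≟ᵇ true))
  ... | yes found = found
  ... | no none   = contradiction
    (proj₂ C≐C⊥ λ c∈C → ¬-not λ x·c≡true → none (_ , c∈C , x·c≡true)) x∉C

  -- Self-orthogonality makes the weight even. Halving once more leaves the bit `b`, which is the
  -- class of `c` modulo C₀.
  wt-codeword : ∀ {c} → c ∈ words C → ∃₂ λ b k → wt c ≡ bit b ℕ.* 2 ℕ.+ k ℕ.* 4
  wt-codeword {c} c∈C with wt-self c
  ... | k , eq with halve k
  ... | b , j , refl = b , j , (begin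
    wt c                                      ≡⟨ eq ⟩
    bit (c · c) ℕ.+ (bit b ℕ.+ j ℕ.* 2) ℕ.* 2 ≡⟨ cong (λ v → bit v ℕ.+ _) (orthogonal c∈C c∈C) ⟩
    (bit b ℕ.+ j ℕ.* 2) ℕ.* 2                 ≡⟨ regroup (bit b) j ⟩
    bit b ℕ.* 2 ℕ.+ j ℕ.* 4                   ∎)
    where
    regroup : ∀ b j → (b ℕ.+ j ℕ.* 2) ℕ.* 2 ≡ b ℕ.* 2 ℕ.+ j ℕ.* 4
    regroup = ℕRing.solve-∀

  doublyEven⇒C₀ : ∀ {c k} → c ∈ words C → wt c ≡ k ℕ.* 4 → c ∈ C₀ C
  doublyEven⇒C₀ {k = k} c∈C eq = c∈C , trans (cong (_% 4) eq) ([m+kn]%n≡m%n 0 k 4)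

  -- Two codewords of weight 2 mod 4 have a sum in C₀, as they meet in an even set.
  shadow-· : ∀ {x c} b k → x ∈ shadow C → c ∈ words C → wt c ≡ bit b ℕ.* 2 ℕ.+ k ℕ.* 4 → x · c ≡ b
  shadow-· false k (x⊥C₀ , _) c∈C wt-c = x⊥C₀ (doublyEven⇒C₀ {k = k} c∈C wt-c)
  -- Since `x` is not in C, some codeword `c′` has `x · c′ ≡ true`. It lies outside C₀, so its
  -- weight is 2 mod 4 and `c ⊕ c′` is in C₀.
  shadow-· {x} {c} true k (x⊥C₀ , x∉C) c∈C wt-c with nonorthogonal-codeword x∉C
  ... | c′ , c′∈C , x·c′≡true with wt-codeword c′∈C
  ... | false , k′ , wt-c′ =
    contradiction (trans (sym (x⊥C₀ (doublyEven⇒C₀ {k = k′} c′∈C wt-c′))) x·c′≡true) λ ()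
  ... | true , k′ , wt-c′ with wt-⊕ c c′
  ... | j , wt-c⊕c′ = xor-trueʳ (begin
    (x · c) xor true     ≡⟨ cong ((x · c) xor_) x·c′≡true ⟨
    (x · c) xor (x · c′) ≡⟨ ·-distribˡ-⊕ x c c′ ⟨
    x · (c ⊕ c′)         ≡⟨ x⊥C₀ (⊕-closed C c∈C c′∈C , wt-c⊕c′-%4) ⟩
    false                ∎)
    where
    xor-trueʳ : ∀ {b} → b xor true ≡ false → b ≡ true
    xor-trueʳ {true} _ = refl

    regroup : ∀ k k′ → (2 ℕ.+ k ℕ.* 4) ℕ.+ (2 ℕ.+ k′ ℕ.* 4) ≡ 0 ℕ.+ (1 ℕ.+ k ℕ.+ k′) ℕ.* 4
    regroup = ℕRing.solve-∀

    regroup′ : ∀ w j → w ℕ.+ (0 ℕ.+ j ℕ.* 2) ℕ.* 2 ≡ w ℕ.+ j ℕ.* 4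
    regroup′ = ℕRing.solve-∀

    wt-c⊕c′-%4 : wt (c ⊕ c′) % 4 ≡ 0
    wt-c⊕c′-%4 = begin
      wt (c ⊕ c′) % 4
        ≡⟨ [m+kn]%n≡m%n (wt (c ⊕ c′)) j 4 ⟨
      (wt (c ⊕ c′) ℕ.+ j ℕ.* 4) % 4
        ≡⟨ cong (_% 4) (regroup′ (wt (c ⊕ c′)) j) ⟨
      (wt (c ⊕ c′) ℕ.+ (0 ℕ.+ j ℕ.* 2) ℕ.* 2) % 4
        ≡⟨ cong (λ v → (wt (c ⊕ c′) ℕ.+ (bit v ℕ.+ j ℕ.* 2) ℕ.* 2) % 4) (orthogonal c∈C c′∈C) ⟨
      (wt (c ⊕ c′) ℕ.+ (bit (c · c′) ℕ.+ j ℕ.* 2) ℕ.* 2) % 4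
        ≡⟨ cong (_% 4) (trans wt-c⊕c′ (trans (cong₂ ℕ._+_ wt-c wt-c′) (regroup k k′))) ⟩
      (0 ℕ.+ (1 ℕ.+ k ℕ.+ k′) ℕ.* 4) % 4
        ≡⟨ [m+kn]%n≡m%n 0 (1 ℕ.+ k ℕ.+ k′) 4 ⟩
      0 ∎

  -- By `shadow-·` all shadow words have the same inner product with a given codeword, so it cancels
  -- in `x ⊕ s`, which then lies in C⊥ = C.
  shadow-⊕-shadow : ∀ {x s} → x ∈ shadow C → s ∈ shadow C → x ⊕ s ∈ words C
  shadow-⊕-shadow {x} {s} x∈S s∈S = proj₂ C≐C⊥ λ {c} c∈C →
    let b , k , wt-c = wt-codeword c∈C in begin
    (x ⊕ s) · c         ≡⟨ ·-distribʳ-⊕ x s c ⟩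
    (x · c) xor (s · c) ≡⟨ cong₂ _xor_ (shadow-· b k x∈S c∈C wt-c) (shadow-· b k s∈S c∈C wt-c) ⟩
    b xor b             ≡⟨ xor-same b ⟩
    false               ∎

  -- With `shadow-⊕-shadow` this gives S = s ⊕ C. If `c ⊕ s` were in C, adding `c` again would put
  -- `s` in C.
  code-⊕-shadow : ∀ {c s} → c ∈ words C → s ∈ shadow C → c ⊕ s ∈ shadow C
  code-⊕-shadow {c} {s} c∈C (s⊥C₀ , s∉C) =
    (λ {c₀} c₀∈C₀ → trans (·-distribʳ-⊕ c s c₀)
      (cong₂ _xor_ (orthogonal c∈C (proj₁ c₀∈C₀)) (s⊥C₀ c₀∈C₀))) ,
    λ c⊕s∈C → s∉C (subst (_∈ words C) (trans (cong (_⊕ c) (⊕-comm c s)) (⊕-cancelʳ s c))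
                                       (⊕-closed C c⊕s∈C c∈C))

  -- Codewords have even weight, so the all-ones word is in C⊥ = C.
  1ʷ∈C : 1ʷ ∈ words C
  1ʷ∈C = proj₂ C≐C⊥ λ {c} c∈C → trans (·-1ʷ c) (orthogonal c∈C c∈C)

  -- Turns lower bounds on shadow weights into upper bounds.
  complement∈shadow : ∀ {x} → x ∈ shadow C → 1ʷ ⊕ x ∈ shadow C
  complement∈shadow = code-⊕-shadow 1ʷ∈C

  -- Put c = x ⊕ s, so that wt x = wt s + wt c - 2 wt (s ∩ c). The last two terms cancel mod 4: wt c
  -- ≡ 2b, and s · c = b by `shadow-·`.
  wt-shadow-%4 : ∀ {x s} → x ∈ shadow C → s ∈ shadow C → wt x % 4 ≡ wt s % 4
  wt-shadow-%4 {x} {s} x∈S s∈S with wt-codeword c∈C | wt-⊕ s (x ⊕ s)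
    where c∈C = shadow-⊕-shadow x∈S s∈S
  ... | b , k , wt-c | j , wt-sum = begin
    wt x % 4                  ≡⟨ [m+kn]%n≡m%n (wt x) j 4 ⟨
    (wt x ℕ.+ j ℕ.* 4) % 4    ≡⟨ cong (_% 4) (ℕ.+-cancelʳ-≡ (bit b ℕ.* 2) _ _ weights) ⟩
    (wt s ℕ.+ k ℕ.* 4) % 4    ≡⟨ [m+kn]%n≡m%n (wt s) k 4 ⟩
    wt s % 4                  ∎
    where
    regroup : ∀ w b j → w ℕ.+ j ℕ.* 4 ℕ.+ b ℕ.* 2 ≡ w ℕ.+ (b ℕ.+ j ℕ.* 2) ℕ.* 2
    regroup = ℕRing.solve-∀

    regroup′ : ∀ w b k → w ℕ.+ (b ℕ.* 2 ℕ.+ k ℕ.* 4) ≡ w ℕ.+ k ℕ.* 4 ℕ.+ b ℕ.* 2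
    regroup′ = ℕRing.solve-∀

    weights : wt x ℕ.+ j ℕ.* 4 ℕ.+ bit b ℕ.* 2 ≡ wt s ℕ.+ k ℕ.* 4 ℕ.+ bit b ℕ.* 2
    weights = begin
      wt x ℕ.+ j ℕ.* 4 ℕ.+ bit b ℕ.* 2
        ≡⟨ regroup (wt x) (bit b) j ⟩
      wt x ℕ.+ (bit b ℕ.+ j ℕ.* 2) ℕ.* 2
        ≡⟨ cong₂ (λ u v → wt u ℕ.+ (bit v ℕ.+ j ℕ.* 2) ℕ.* 2)
             (trans (⊕-comm s (x ⊕ s)) (⊕-cancelʳ x s))
             (shadow-· b k s∈S (shadow-⊕-shadow x∈S s∈S) wt-c) ⟨
      wt (s ⊕ (x ⊕ s)) ℕ.+ (bit (s · (x ⊕ s)) ℕ.+ j ℕ.* 2) ℕ.* 2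
        ≡⟨ trans wt-sum (cong (wt s ℕ.+_) wt-c) ⟩
      wt s ℕ.+ (bit b ℕ.* 2 ℕ.+ k ℕ.* 4)
        ≡⟨ regroup′ (wt s) (bit b) k ⟩
      wt s ℕ.+ k ℕ.* 4 ℕ.+ bit b ℕ.* 2 ∎

  -- Indicator functions and character sums over the code.

  1C 1S : Word n → ℤ
  1C x = ⟦ words? C x ⟧
  1S x = ⟦ shadow? C x ⟧

  ∣C∣ : ℤ
  ∣C∣ = ∑ 1C

  1C-translate : ∀ {c} → c ∈ words C → ∀ x → 1C (x ⊕ c) ≡ 1C x
  1C-translate {c} c∈C x = ⟦⟧-cong (words? C (x ⊕ c)) (words? C x) $ mk⇔
    (λ x⊕c∈C → subst (_∈ words C) (⊕-cancelʳ x c) (⊕-closed C x⊕c∈C c∈C))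
    (λ x∈C → ⊕-closed C x∈C c∈C)

  1S-translate : ∀ {s} → s ∈ shadow C → ∀ x → 1S (x ⊕ s) ≡ 1C x
  1S-translate {s} s∈S x = ⟦⟧-cong (shadow? C (x ⊕ s)) (words? C x) $ mk⇔
    (λ x⊕s∈S → subst (_∈ words C) (⊕-cancelʳ x s) (shadow-⊕-shadow x⊕s∈S s∈S))
    (λ x∈C → code-⊕-shadow x∈C s∈S)

  1C-translate-shadow : ∀ {s} → s ∈ shadow C → ∀ x → 1C (x ⊕ s) ≡ 1S x
  1C-translate-shadow {s} s∈S x = trans (sym (1S-translate s∈S (x ⊕ s))) (cong 1S (⊕-cancelʳ x s))

  -- Orthogonality of characters: the signs are all 1 if `u` is in C; otherwise translation by a
  -- codeword not orthogonal to `u` negates the sum.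
  ∑-sign-code : ∀ u → ∑ (λ c → 1C c * sign (c · u)) ≡ ∣C∣ * 1C u
  ∑-sign-code u with words? C u
  ... | yes u∈C = trans (∑-cong trivial) (sym (*-identityʳ ∣C∣))
    where
    trivial : ∀ c → 1C c * sign (c · u) ≡ 1C c
    trivial c with words? C c
    ... | yes c∈C = cong (λ b → + 1 * sign b) (orthogonal c∈C u∈C)
    ... | no  _   = refl
  ... | no u∉C with c , c∈C , u·c≡true ← nonorthogonal-codeword u∉C =
    trans (a≡-a⇒a≡0 (begin
      ∑ φ                      ≡⟨ ∑-translate c φ ⟨
      ∑ (λ x → φ (x ⊕ c))      ≡⟨ ∑-cong (antiperiodic u·c≡true) ⟩
      ∑ (λ x → - + 1 * φ x)    ≡⟨ ∑-* (- + 1) φ ⟩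
      - + 1 * ∑ φ              ∎)) (sym (*-zeroʳ ∣C∣))
    where
    φ : Word n → ℤ
    φ x = 1C x * sign (x · u)

    swap : ∀ a b → a * (b * - + 1) ≡ - + 1 * (a * b)
    swap = solve-∀

    antiperiodic : u · c ≡ true → ∀ x → φ (x ⊕ c) ≡ - + 1 * φ x
    antiperiodic u·c≡true x = begin
      1C (x ⊕ c) * sign ((x ⊕ c) · u)
        ≡⟨ cong₂ (λ i b → i * sign b) (1C-translate c∈C x) (·-distribʳ-⊕ x c u) ⟩
      1C x * sign ((x · u) xor (c · u))
        ≡⟨ cong (1C x *_) (trans (sign-xor (x · u) (c · u))
             (cong (λ b → sign (x · u) * sign b) (trans (·-comm c u) u·c≡true))) ⟩
      1C x * (sign (x · u) * - + 1)
        ≡⟨ swap (1C x) (sign (x · u)) ⟩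
      - + 1 * φ x ∎

  1C-0ʷ : 1C 0ʷ ≡ + 1
  1C-0ʷ with words? C 0ʷ
  ... | yes _  = refl
  ... | no 0∉C = contradiction (0-closed C) 0∉C

  -- Double count of the signs of c · u over c in C and all u: summing over c first gives ∣C∣²,
  -- summing over u first leaves only c = 0, with 2ⁿ.
  ∣C∣²≡2ⁿ : ∣C∣ * ∣C∣ ≡ + (2 ℕ.^ n)
  ∣C∣²≡2ⁿ = begin
    ∣C∣ * ∣C∣
      ≡⟨ ∑-* ∣C∣ 1C ⟨
    ∑ (λ u → ∣C∣ * 1C u)
      ≡⟨ ∑-cong ∑-sign-code ⟨
    ∑ (λ u → ∑ (λ c → 1C c * sign (c · u)))
      ≡⟨ ∑-swap (λ u c → 1C c * sign (c · u)) ⟩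
    ∑ (λ c → ∑ (λ u → 1C c * sign (c · u)))
      ≡⟨ ∑-cong (λ c → trans (∑-* (1C c) (λ u → sign (c · u))) (cong (1C c *_) (∑-sign c))) ⟩
    ∑ (λ c → 1C c * (+ (2 ℕ.^ n) * + (zeros c choose n)))
      ≡⟨ ∑-cong (λ c → swap (1C c) (+ (2 ℕ.^ n)) (+ (zeros c choose n))) ⟩
    ∑ (λ c → + (2 ℕ.^ n) * (1C c * + (zeros c choose n)))
      ≡⟨ ∑-* (+ (2 ℕ.^ n)) (λ c → 1C c * + (zeros c choose n)) ⟩
    + (2 ℕ.^ n) * ∑ (λ c → 1C c * + (zeros c choose n))
      ≡⟨ cong (+ (2 ℕ.^ n) *_) (trans (∑-select-0ʷ 1C) 1C-0ʷ) ⟩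
    + (2 ℕ.^ n) * + 1
      ≡⟨ *-identityʳ _ ⟩
    + (2 ℕ.^ n) ∎
    where
    swap : ∀ a b c → a * (b * c) ≡ b * (a * c)
    swap = solve-∀

    -- The binomial moment with i = n and r = 0, where `zeros u choose 0` is 1.
    ∑-sign : ∀ c → ∑ (λ u → sign (c · u)) ≡ + (2 ℕ.^ n) * + (zeros c choose n)
    ∑-sign c = trans (∑-cong λ u → sym (*-identityʳ (sign (c · u))))
                     (∑-sign-binomial c n 0 (ℕ.+-identityʳ n))

  -- `∣C∣` is a count, hence nonnegative, so its square determines it.
  ∣C∣≡2ᵐ : ∀ m → m ℕ.+ m ≡ n → ∣C∣ ≡ + (2 ℕ.^ m)
  ∣C∣≡2ᵐ m m+m≡n = trans ∣C∣≡+k (cong +_ (square-injective (ℤ.+-injective (begin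
    + (k ℕ.* k)                   ≡⟨ pos-* k k ⟩
    + k * + k                     ≡⟨ cong₂ _*_ ∣C∣≡+k ∣C∣≡+k ⟨
    ∣C∣ * ∣C∣                     ≡⟨ ∣C∣²≡2ⁿ ⟩
    + (2 ℕ.^ n)                   ≡⟨ cong (λ v → + (2 ℕ.^ v)) m+m≡n ⟨
    + (2 ℕ.^ (m ℕ.+ m))           ≡⟨ cong +_ (ℕ.^-distribˡ-+-* 2 m m) ⟩
    + (2 ℕ.^ m ℕ.* 2 ℕ.^ m)       ∎))))
    where
    k : ℕ
    k = length (filter (words? C) (allWords n))

    ∣C∣≡+k : ∣C∣ ≡ + k
    ∣C∣≡+k = sym (count≡∑ (words? C))

  -- Weight counts of the shadow, plain and signed.

  shadow-weight-count : ∀ k → + weightEnumerator (shadow? C) k ≡ ∑ (λ x → 1S x * ⟦ wt x ≟ k ⟧)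
  shadow-weight-count k = trans (count≡∑ (λ x → shadow? C x ×-dec (wt x ≟ k)))
                                (∑-cong λ x → ⟦×⟧ (shadow? C x) (wt x ≟ k))

  no-weight⇒count≡0 : ∀ k → (∀ {x} → x ∈ shadow C → wt x ≢ k) → + weightEnumerator (shadow? C) k ≡ + 0
  no-weight⇒count≡0 k no-weight = trans (count≡∑ (λ x → shadow? C x ×-dec (wt x ≟ k))) (∑-zero λ x →
    ⟦⟧-cong (shadow? C x ×-dec (wt x ≟ k)) (no λ ()) (mk⇔ (λ (x∈S , wt-x) → no-weight x∈S wt-x) ⊥-elim))

  -- With s ∈ S, the sign of s · x separates the two cosets of C₀ that make up S.
  module _ {s : Word n} (s∈S : s ∈ shadow C) (s·s≡true : s · s ≡ true) where

    signedShadow : Word n → ℤ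
    signedShadow x = 1S x * sign (s · x)

    -- The signed indicator of the shadow is an eigenfunction of the Hadamard transform,
    -- since S is the coset s ⊕ C and C is its own dual.
    ∑-signedShadow-sign : ∀ y → ∑ (λ x → signedShadow x * sign (x · y)) ≡ - ∣C∣ * signedShadow y
    ∑-signedShadow-sign y = begin
      ∑ (λ x → 1S x * sign (s · x) * sign (x · y))
        ≡⟨ ∑-cong merge ⟩
      ∑ φ
        -- The substitution x = c ⊕ s turns the sum over S into a sum over C.
        ≡⟨ ∑-translate s φ ⟨
      ∑ (λ c → 1S (c ⊕ s) * sign ((c ⊕ s) · (y ⊕ s)))
        ≡⟨ ∑-cong split ⟩
      ∑ (λ c → sign (s · (y ⊕ s)) * (1C c * sign (c · (y ⊕ s))))
        ≡⟨ ∑-* (sign (s · (y ⊕ s))) (λ c → 1C c * sign (c · (y ⊕ s))) ⟩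
      sign (s · (y ⊕ s)) * ∑ (λ c → 1C c * sign (c · (y ⊕ s)))
        ≡⟨ cong₂ _*_ sign-s·[y⊕s] (trans (∑-sign-code (y ⊕ s)) (cong (∣C∣ *_) (1C-translate-shadow s∈S y))) ⟩
      sign (s · y) * - + 1 * (∣C∣ * 1S y)
        ≡⟨ regroup (sign (s · y)) ∣C∣ (1S y) ⟩
      - ∣C∣ * (1S y * sign (s · y)) ∎
      where
      φ : Word n → ℤ
      φ x = 1S x * sign (x · (y ⊕ s))

      regroup : ∀ a b c → a * - + 1 * (b * c) ≡ - b * (c * a)
      regroup = solve-∀

      swap : ∀ a b c → a * (b * c) ≡ c * (a * b)
      swap = solve-∀

      merge : ∀ x → 1S x * sign (s · x) * sign (x · y) ≡ φ x
      merge x = begin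
        1S x * sign (s · x) * sign (x · y)   ≡⟨ *-assoc (1S x) _ _ ⟩
        1S x * (sign (s · x) * sign (x · y)) ≡⟨ cong (1S x *_) (*-comm (sign (s · x)) _) ⟩
        1S x * (sign (x · y) * sign (s · x)) ≡⟨ cong (λ b → 1S x * (sign (x · y) * sign b)) (·-comm s x) ⟩
        1S x * (sign (x · y) * sign (x · s)) ≡⟨ cong (1S x *_) (sign-xor (x · y) (x · s)) ⟨
        1S x * sign ((x · y) xor (x · s))    ≡⟨ cong (λ b → 1S x * sign b) (·-distribˡ-⊕ x y s) ⟨
        1S x * sign (x · (y ⊕ s))            ∎

      split : ∀ c → φ (c ⊕ s) ≡ sign (s · (y ⊕ s)) * (1C c * sign (c · (y ⊕ s)))
      split c = begin
        1S (c ⊕ s) * sign ((c ⊕ s) · (y ⊕ s))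
          ≡⟨ cong₂ _*_ (1S-translate s∈S c)
               (trans (cong sign (·-distribʳ-⊕ c s (y ⊕ s))) (sign-xor (c · (y ⊕ s)) _)) ⟩
        1C c * (sign (c · (y ⊕ s)) * sign (s · (y ⊕ s)))
          ≡⟨ swap (1C c) (sign (c · (y ⊕ s))) _ ⟩
        sign (s · (y ⊕ s)) * (1C c * sign (c · (y ⊕ s))) ∎

      -- The minus sign of the eigenvalue comes from the odd weight of `s`.
      sign-s·[y⊕s] : sign (s · (y ⊕ s)) ≡ sign (s · y) * - + 1
      sign-s·[y⊕s] = trans (cong sign (·-distribˡ-⊕ s y s))
        (trans (sign-xor (s · y) (s · s)) (cong (λ b → sign (s · y) * sign b) s·s≡true))

    -- A MacWilliams identity in binomial form. `∑-sign-binomial` writes the first term as a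
    -- transform of `zeros y choose r`; exchanging the sums moves the transform onto `signedShadow`,
    -- where it is multiplication by `- ∣C∣`.
    ∑-signedShadow-binomial : ∀ i r → i ℕ.+ r ≡ n →
      ∑ (λ x → signedShadow x * (+ (2 ℕ.^ i) * + (zeros x choose i) + ∣C∣ * + (zeros x choose r))) ≡ + 0
    ∑-signedShadow-binomial i r i+r≡n = begin
      ∑ (λ x → f x * (+ (2 ℕ.^ i) * + (zeros x choose i) + ∣C∣ * z x))
        ≡⟨ ∑-cong (λ x → expand (f x) (+ (2 ℕ.^ i) * + (zeros x choose i)) ∣C∣ (z x)) ⟩
      ∑ (λ x → f x * (+ (2 ℕ.^ i) * + (zeros x choose i)) + ∣C∣ * (f x * z x))
        ≡⟨ ∑-+ (λ x → f x * (+ (2 ℕ.^ i) * + (zeros x choose i))) (λ x → ∣C∣ * (f x * z x)) ⟩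
      ∑ (λ x → f x * (+ (2 ℕ.^ i) * + (zeros x choose i))) + ∑ (λ x → ∣C∣ * (f x * z x))
        ≡⟨ cong₂ _+_ transformed (∑-* ∣C∣ (λ x → f x * z x)) ⟩
      - ∣C∣ * ∑ (λ x → f x * z x) + ∣C∣ * ∑ (λ x → f x * z x)
        ≡⟨ cancel ∣C∣ _ ⟩
      + 0 ∎
      where
      f z : Word n → ℤ
      f = signedShadow
      z x = + (zeros x choose r)

      expand : ∀ f a c z → f * (a + c * z) ≡ f * a + c * (f * z)
      expand = solve-∀

      cancel : ∀ a b → - a * b + a * b ≡ + 0
      cancel = solve-∀

      swap : ∀ a b c → a * (b * c) ≡ c * (a * b)
      swap = solve-∀

      swap′ : ∀ a b c → a * (b * c) ≡ b * (c * a)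
      swap′ = solve-∀

      transformed : ∑ (λ x → f x * (+ (2 ℕ.^ i) * + (zeros x choose i))) ≡ - ∣C∣ * ∑ (λ x → f x * z x)
      transformed = begin
        ∑ (λ x → f x * (+ (2 ℕ.^ i) * + (zeros x choose i)))
          ≡⟨ ∑-cong (λ x → trans (cong (f x *_) (sym (∑-sign-binomial x i r i+r≡n)))
                                 (sym (∑-* (f x) (λ y → sign (x · y) * z y)))) ⟩
        ∑ (λ x → ∑ (λ y → f x * (sign (x · y) * z y)))
          ≡⟨ ∑-swap (λ x y → f x * (sign (x · y) * z y)) ⟩
        ∑ (λ y → ∑ (λ x → f x * (sign (x · y) * z y)))
          ≡⟨ ∑-cong (λ y → trans (∑-cong λ x → swap (f x) (sign (x · y)) (z y))
                           (trans (∑-* (z y) (λ x → f x * sign (x · y)))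
                                  (cong (z y *_) (∑-signedShadow-sign y)))) ⟩
        ∑ (λ y → z y * (- ∣C∣ * f y))
          ≡⟨ ∑-cong (λ y → swap′ (z y) (- ∣C∣) (f y)) ⟩
        ∑ (λ y → - ∣C∣ * (f y * z y))
          ≡⟨ ∑-* (- ∣C∣) (λ y → f y * z y) ⟩
        - ∣C∣ * ∑ (λ x → f x * z x) ∎

    -- The moment identities for consecutive indices from `i` on are added with weights `ls`. The
    -- bound keeps the last index at most `n`, so that `n ∸ i` is a true difference.
    ∑-signedShadow-combination : ∀ ls i → i ℕ.+ length ls ≤ suc n →
      ∑ (λ x → signedShadow x * binomialCombination n ∣C∣ ls i (zeros x)) ≡ + 0
    ∑-signedShadow-combination []       i _ = ∑-zero λ x → *-zeroʳ (signedShadow x)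
    ∑-signedShadow-combination (l ∷ ls) i i+[1+m]≤1+n = begin
      ∑ (λ x → f x * (l * g x + h x))
        ≡⟨ ∑-cong (λ x → expand (f x) l (g x) (h x)) ⟩
      ∑ (λ x → l * (f x * g x) + f x * h x)
        ≡⟨ ∑-+ (λ x → l * (f x * g x)) (λ x → f x * h x) ⟩
      ∑ (λ x → l * (f x * g x)) + ∑ (λ x → f x * h x)
        ≡⟨ cong₂ _+_ (trans (∑-* l (λ x → f x * g x))
                            (cong (l *_) (∑-signedShadow-binomial i (n ℕ.∸ i) (ℕ.m+[n∸m]≡n i≤n))))
                     (∑-signedShadow-combination ls (suc i) 1+i+m≤1+n) ⟩
      l * + 0 + + 0
        ≡⟨ trans (ℤ.+-identityʳ (l * + 0)) (*-zeroʳ l) ⟩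
      + 0 ∎
      where
      f g h : Word n → ℤ
      f = signedShadow
      g x = + (2 ℕ.^ i) * + (zeros x choose i) + ∣C∣ * + (zeros x choose (n ℕ.∸ i))
      h x = binomialCombination n ∣C∣ ls (suc i) (zeros x)

      expand : ∀ f l g h → f * (l * g + h) ≡ l * (f * g) + f * h
      expand = solve-∀

      1+i+m≤1+n : suc i ℕ.+ length ls ≤ suc n
      1+i+m≤1+n = subst (_≤ suc n) (ℕ.+-suc i (length ls)) i+[1+m]≤1+n

      i≤n : i ≤ n
      i≤n = ℕ.≤-trans (ℕ.m≤m+n i (length ls)) (ℕ.s≤s⁻¹ 1+i+m≤1+n)

    -- `signedShadow` vanishes off S, so values matter only there. The factor `a` clears
    -- denominators and cancels at the end.
    ∑-signedShadow-certificate : ∀ ls a .{{_ : NonZero a}} (g : ℕ → ℤ) → length ls ≤ suc n →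
      (∀ {x} → x ∈ shadow C → binomialCombination n ∣C∣ ls 0 (zeros x) ≡ a * g (wt x)) →
      ∑ (λ x → signedShadow x * g (wt x)) ≡ + 0
    ∑-signedShadow-certificate ls a g ls≤ on-shadow = ℤ.*-cancelˡ-≡ a _ (+ 0) (begin
      a * ∑ (λ x → signedShadow x * g (wt x))
        ≡⟨ ∑-* a (λ x → signedShadow x * g (wt x)) ⟨
      ∑ (λ x → a * (signedShadow x * g (wt x)))
        ≡⟨ ∑-cong pointwise ⟨
      ∑ (λ x → signedShadow x * h x)
        ≡⟨ ∑-signedShadow-combination ls 0 ls≤ ⟩
      + 0
        ≡⟨ *-zeroʳ a ⟨
      a * + 0 ∎)
      where
      h : Word n → ℤ
      h x = binomialCombination n ∣C∣ ls 0 (zeros x)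

      regroup : ∀ i b a t → i * (b * (a * t)) ≡ a * (i * b * t)
      regroup = solve-∀

      pointwise : ∀ x → signedShadow x * h x ≡ a * (signedShadow x * g (wt x))
      pointwise x = begin
        1S x * sign (s · x) * h x
          ≡⟨ *-assoc (1S x) (sign (s · x)) (h x) ⟩
        1S x * (sign (s · x) * h x)
          ≡⟨ ⟦⟧-*-cong (shadow? C x) (λ x∈S → cong (sign (s · x) *_) (on-shadow x∈S)) ⟩
        1S x * (sign (s · x) * (a * g (wt x)))
          ≡⟨ regroup (1S x) (sign (s · x)) a (g (wt x)) ⟩
        a * (1S x * sign (s · x) * g (wt x)) ∎

    signedCount : ℕ → ℤ
    signedCount k = ∑ (λ x → signedShadow x * ⟦ wt x ≟ k ⟧)

    -- From 1 = `sign b` + 2 `bit b`: the defect counts twice the words with `s · x` equal to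
    -- `true`.
    signedCount-parity : ∀ k → ∃ λ e → + weightEnumerator (shadow? C) k ≡ signedCount k + + 2 * e
    signedCount-parity k = ∑ e , (begin
      + weightEnumerator (shadow? C) k
        ≡⟨ shadow-weight-count k ⟩
      ∑ (λ x → 1S x * ⟦ wt x ≟ k ⟧)
        ≡⟨ ∑-cong (λ x → split (1S x) ⟦ wt x ≟ k ⟧ (s · x)) ⟩
      ∑ (λ x → signedShadow x * ⟦ wt x ≟ k ⟧ + + 2 * e x)
        ≡⟨ ∑-+ (λ x → signedShadow x * ⟦ wt x ≟ k ⟧) (λ x → + 2 * e x) ⟩
      signedCount k + ∑ (λ x → + 2 * e x)
        ≡⟨ cong (_+_ (signedCount k)) (∑-* (+ 2) e) ⟩
      signedCount k + + 2 * ∑ e ∎)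
      where
      e : Word n → ℤ
      e x = + bit (s · x) * (1S x * ⟦ wt x ≟ k ⟧)

      sign-false : ∀ a d → a * d ≡ a * + 1 * d + + 2 * (+ 0 * (a * d))
      sign-false = solve-∀

      sign-true : ∀ a d → a * d ≡ a * - + 1 * d + + 2 * (+ 1 * (a * d))
      sign-true = solve-∀

      split : ∀ a d b → a * d ≡ a * sign b * d + + 2 * (+ bit b * (a * d))
      split a d false = sign-false a d
      split a d true  = sign-true a d

-- The certificate for length 82.

target : ℕ → ℤ
target w = ⟦ w ≟ 13 ⟧ + + 14 * ⟦ w ≟ 9 ⟧ + + 105 * ⟦ w ≟ 5 ⟧

-- Opaque, so that no product with these numbers is ever unfolded in unary.
opaque

  -- Coefficients, in the basis 2ⁱ (z choose i), of a multiple of (z − 5)(z − 9)⋯(z − 65).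
  -- With z = n − w this kills the weights w = 17, 21, …, 77.
  certificate : List ℤ
  certificate =
    + 627082176452550 ∷ - + 172803599870947 ∷ + 44578372806019 ∷ - + 10726080807507 ∷
    + 2396729944379 ∷ - + 494781904175 ∷ + 93783136047 ∷ - + 16198162363 ∷ + 2525698543 ∷
    - + 351381045 ∷ + 42964565 ∷ - + 4525949 ∷ + 399597 ∷ - + 28405 ∷ + 1525 ∷ - + 55 ∷ + 1 ∷ []

  -- The value of the combination at weight 13; its values at weights 9 and 5 are 14 and 105 times
  -- as large.
  scale : ℤ
  scale = + 686095255732224

  length-certificate : length certificate ≡ 17
  length-certificate = refl

  scale-nonZero : NonZero scale
  scale-nonZero = _

  -- A finite check of w = 5, 9, ..., 77. For w ≥ 17 there are at most 65 zeros, while 82 - i ≥ 66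
  -- for i ≤ 16, so the terms with 2⁴¹ vanish and only the polynomial is left. At 13, 9 and 5 both
  -- kinds of term contribute.
  certificate-on-weights : ∀ {w} → w < 83 → w % 4 ≡ 1 → 5 ≤ w → 5 ≤ 82 ℕ.∸ w →
    binomialCombination 82 (+ (2 ℕ.^ 41)) certificate 0 (82 ℕ.∸ w) ≡ scale * target w
  certificate-on-weights = toWitness {a? = ℕ.allUpTo? (λ w →
    (w % 4 ≟ 1) →-dec ((5 ℕ.≤? w) →-dec ((5 ℕ.≤? 82 ℕ.∸ w) →-dec
      (binomialCombination 82 (+ (2 ℕ.^ 41)) certificate 0 (82 ℕ.∸ w) ℤ.≟ scale * target w)))) 83} tt

-- For a variable n with n ≡ 82, so that no sum over the 2⁸² words is ever unfolded.
signedCount-relation : n ≡ 82 → (C : Code n) (C≐C⊥ : SelfDual C) → (∀ {x} → x ∈ shadow C → 5 ≤ wt x) →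
  let open SelfDualCode C C≐C⊥ in
  ∀ {s} (s∈S : s ∈ shadow C) (s·s≡true : s · s ≡ true) → wt s % 4 ≡ 1 →
  signedCount s∈S s·s≡true 13 + + 14 * signedCount s∈S s·s≡true 9
    + + 105 * signedCount s∈S s·s≡true 5 ≡ + 0
signedCount-relation {n} n≡82 C C≐C⊥ 5≤wt {s} s∈S s·s≡true wt-s = trans (sym ∑-target)
  (∑-signedShadow-certificate s∈S s·s≡true certificate scale {{scale-nonZero}} target
    (subst₂ (λ m n → m ≤ suc n) (sym length-certificate) (sym n≡82) (ℕ.m≤m+n 17 66)) on-shadow)
  where
  open SelfDualCode C C≐C⊥

  f : Word n → ℤ
  f = signedShadow s∈S s·s≡true

  D : ℕ → ℤ
  D = signedCount s∈S s·s≡true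

  δ : ℕ → Word n → ℤ
  δ k x = ⟦ wt x ≟ k ⟧

  expand : ∀ f a b c → f * (a + + 14 * b + + 105 * c) ≡ f * a + + 14 * (f * b) + + 105 * (f * c)
  expand = solve-∀

  ∑-target : ∑ (λ x → f x * target (wt x)) ≡ D 13 + + 14 * D 9 + + 105 * D 5
  ∑-target = begin
    ∑ (λ x → f x * target (wt x))
      ≡⟨ ∑-cong (λ x → expand (f x) (δ 13 x) (δ 9 x) (δ 5 x)) ⟩
    ∑ (λ x → f x * δ 13 x + + 14 * (f x * δ 9 x) + + 105 * (f x * δ 5 x))
      ≡⟨ ∑-+ (λ x → f x * δ 13 x + + 14 * (f x * δ 9 x)) (λ x → + 105 * (f x * δ 5 x)) ⟩
    ∑ (λ x → f x * δ 13 x + + 14 * (f x * δ 9 x)) + ∑ (λ x → + 105 * (f x * δ 5 x))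
      ≡⟨ cong₂ _+_
           (trans (∑-+ (λ x → f x * δ 13 x) (λ x → + 14 * (f x * δ 9 x)))
                  (cong (_+_ (D 13)) (∑-* (+ 14) (λ x → f x * δ 9 x))))
           (∑-* (+ 105) (λ x → f x * δ 5 x)) ⟩
    D 13 + + 14 * D 9 + + 105 * D 5 ∎

  on-shadow : ∀ {x} → x ∈ shadow C →
              binomialCombination n ∣C∣ certificate 0 (zeros x) ≡ scale * target (wt x)
  on-shadow {x} x∈S = begin
    binomialCombination n ∣C∣ certificate 0 (zeros x)
      ≡⟨ cong₂ (λ N z → binomialCombination n N certificate 0 z)
           (∣C∣≡2ᵐ 41 (sym n≡82)) (∣∁p∣≡n∸∣p∣ x) ⟩
    binomialCombination n (+ (2 ℕ.^ 41)) certificate 0 (n ℕ.∸ wt x)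
      ≡⟨ cong (λ n → binomialCombination n (+ (2 ℕ.^ 41)) certificate 0 (n ℕ.∸ wt x)) n≡82 ⟩
    binomialCombination 82 (+ (2 ℕ.^ 41)) certificate 0 (82 ℕ.∸ wt x)
      ≡⟨ certificate-on-weights
           (s≤s (subst (wt x ≤_) n≡82 (∣p∣≤n x)))
           (trans (wt-shadow-%4 x∈S s∈S) wt-s)
           (5≤wt x∈S)
           -- The complement of `x` is also in S, whence wt x ≤ 77.
           (subst (5 ≤_) (trans (wt-1ʷ⊕ x) (cong (ℕ._∸ wt x) n≡82)) (5≤wt (complement∈shadow x∈S))) ⟩
    scale * target (wt x) ∎

-- Parity of B₅ + B₁₃ and of β.

shadow-counts-even : n ≡ 82 → (C : Code n) → SelfDual C → (∀ {x} → x ∈ shadow C → 5 ≤ wt x) →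
  ∃ λ t → + weightEnumerator (shadow? C) 5 + + weightEnumerator (shadow? C) 13 ≡ + 2 * t
shadow-counts-even n≡82 C C≐C⊥ 5≤wt = by-cases (anySubset? (λ x → shadow? C x ×-dec (wt x % 4 ≟ 1)))
  where
  open SelfDualCode C C≐C⊥

  -- Modulo 2 the relation reads D₁₃ + D₅, since 14 = 2 · 7 and 105 = 1 + 2 · 52.
  collect : ∀ d₅ d₉ d₁₃ e₅ e₁₃ → (d₅ + + 2 * e₅) + (d₁₃ + + 2 * e₁₃)
    ≡ (d₁₃ + + 14 * d₉ + + 105 * d₅) + + 2 * (e₅ + e₁₃ - + 7 * d₉ - + 52 * d₅)
  collect = solve-∀

  conclude : ∀ {b₅ b₁₃} d₅ d₉ d₁₃ → (∃ λ e → b₅ ≡ d₅ + + 2 * e) → (∃ λ e → b₁₃ ≡ d₁₃ + + 2 * e) →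
             d₁₃ + + 14 * d₉ + + 105 * d₅ ≡ + 0 → ∃ λ t → b₅ + b₁₃ ≡ + 2 * t
  conclude d₅ d₉ d₁₃ (e₅ , refl) (e₁₃ , refl) relation =
    e₅ + e₁₃ - + 7 * d₉ - + 52 * d₅ ,
    trans (collect d₅ d₉ d₁₃ e₅ e₁₃) (trans (cong (λ v → v + _) relation) (ℤ.+-identityˡ _))

  by-cases : Dec (∃ λ x → x ∈ shadow C × wt x % 4 ≡ 1) →
    ∃ λ t → + weightEnumerator (shadow? C) 5 + + weightEnumerator (shadow? C) 13 ≡ + 2 * t
  by-cases (no none) = + 0 , cong₂ _+_
    (no-weight⇒count≡0 5 λ x∈S wt-x → none (_ , x∈S , cong (_% 4) wt-x))
    (no-weight⇒count≡0 13 λ x∈S wt-x → none (_ , x∈S , cong (_% 4) wt-x))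
  by-cases (yes (s , s∈S , wt-s)) = conclude (D 5) (D 9) (D 13)
    (signedCount-parity s∈S s·s≡true 5) (signedCount-parity s∈S s·s≡true 13)
    (signedCount-relation n≡82 C C≐C⊥ 5≤wt s∈S s·s≡true wt-s)
    where
    s·s≡true : s · s ≡ true
    s·s≡true = wt%4≡1⇒odd s wt-s

    D : ℕ → ℤ
    D = signedCount s∈S s·s≡true

-- Here B₅ + B₁₃ = 154 - 16α - β. The zeros in the hypothesis on `b₁₃` are the terms of other
-- exponents, as `coefficient` evaluates them.
β-even-i : ∀ α β {b₅ b₁₃} →
  b₅ ≡ + 1 → b₁₃ ≡ + 0 + (+ 0 + ((+ 153 - + 16 * α - β) + (+ 0 + + 0))) →
  (∃ λ t → b₅ + b₁₃ ≡ + 2 * t) → + 2 ∣ β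
β-even-i α β refl refl (t , sum≡2t) = ∣⇒∣ᵤ (divides (+ 77 - + 8 * α - t)
  (trans (isolate α β) (trans (cong (λ v → + 154 - + 16 * α - v) sum≡2t) (halved α t))))
  where
  isolate : ∀ α β → β ≡ + 154 - + 16 * α - (+ 1 + (+ 0 + (+ 0 + ((+ 153 - + 16 * α - β) + (+ 0 + + 0)))))
  isolate = solve-∀

  halved : ∀ α t → + 154 - + 16 * α - + 2 * t ≡ (+ 77 - + 8 * α - t) * + 2
  halved = solve-∀

β-even-ii : ∀ α β {b₅ b₁₃} →
  b₅ ≡ + 0 → b₁₃ ≡ + 0 + ((- (+ 16) * α - β) + (+ 0 + (+ 0 + + 0))) →
  (∃ λ t → b₅ + b₁₃ ≡ + 2 * t) → + 2 ∣ β
β-even-ii α β refl refl (t , sum≡2t) = ∣⇒∣ᵤ (divides (- (+ 8) * α - t)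
  (trans (isolate α β) (trans (cong (λ v → - (+ 16) * α - v) sum≡2t) (halved α t))))
  where
  isolate : ∀ α β → β ≡ - (+ 16) * α - (+ 0 + (+ 0 + ((- (+ 16) * α - β) + (+ 0 + (+ 0 + + 0)))))
  isolate = solve-∀

  halved : ∀ α t → - (+ 16) * α - + 2 * t ≡ (- (+ 8) * α - t) * + 2
  halved = solve-∀

proposition2 :
  (C : Code 82) → Is[ 82 , 41 , 14 ] C → SelfDual C → SinglyEven C →
  (α β : ℤ) →
  ( LeastWeight (shadow C) 5
  × weightEnumerator (words? C) ≈
      ( + 1 y^ 0
      ∷ (+ 3280 + + 2 * β) y^ 14
      ∷ (+ 36244 + + 128 * α - + 2 * β) y^ 16
      ∷ (+ 506153 - + 896 * α - + 26 * β) y^ 18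
      ∷ [] ) +⋯
  × weightEnumerator (shadow? C) ≈
      ( + 1 y^ 5
      ∷ (- (+ 18) + α) y^ 9
      ∷ (+ 153 - + 16 * α - β) y^ 13
      ∷ (+ 303568 + + 120 * α + + 14 * β) y^ 17
      ∷ [] ) +⋯
  )
  ⊎
  ( (∃ λ d → LeastWeight (shadow C) d × 9 ≤ d)
  × weightEnumerator (words? C) ≈
      ( + 1 y^ 0
      ∷ (+ 3280 + + 2 * β) y^ 14
      ∷ (+ 36244 + + 128 * α - + 2 * β) y^ 16
      ∷ (+ 514345 - + 896 * α - + 26 * β) y^ 18
      ∷ [] ) +⋯
  × weightEnumerator (shadow? C) ≈
      ( α y^ 9
      ∷ (- (+ 16) * α - β) y^ 13
      ∷ (+ 304384 + + 120 * α + + 14 * β) y^ 17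
      ∷ (+ 33293312 - + 560 * α - + 91 * β) y^ 21
      ∷ [] ) +⋯
  ) →
  + 2 ∣ β
proposition2 C _ C≐C⊥ _ α β (inj₁ (S-least , _ , W-S)) =
  β-even-i α β (W-S 5 (ℕ.m≤m+n 5 12)) (W-S 13 (ℕ.m≤m+n 13 4))
    (shadow-counts-even refl C C≐C⊥ (LeastWeight.least S-least))
proposition2 C _ C≐C⊥ _ α β (inj₂ ((_ , S-least , 9≤d) , _ , W-S)) =
  -- The exponent 5 is not written but lies below the formal degree 21, so B₅ = 0.
  β-even-ii α β (W-S 5 (ℕ.m≤m+n 5 16)) (W-S 13 (ℕ.m≤m+n 13 8))
    (shadow-counts-even refl C C≐C⊥ λ x∈S →
      ℕ.≤-trans (ℕ.m≤m+n 5 4) (ℕ.≤-trans 9≤d (LeastWeight.least S-least x∈S)))
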